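{- For every $d\ge 2$ and $k\ge 1$, the digraph $\mathbb{Z}(\vec K_{d+1},k)$ is a two-ended digraph with in- and out-valency equal to $d$ which is sharply $k$-arc-transitive.
   Context: A digraph $\Gamma$ is a pair $(\mathrm V\Gamma,\mathrm E\Gamma)$ with $\mathrm E\Gamma\subseteq \mathrm V\Gamma\times \mathrm V\Gamma$ the set of arcs. The in-valency (out-valency) of a vertex $v$ is the number of $u$ with $(u,v)\in \mathrm E\Gamma$ (respectively $(v,u)\in \mathrm E\Gamma$). A $k$-arc is a sequence $(v_0,\dots,v_k)$ of vertices with $(v_{i-1},v_i)$ an arc for $1\le i\le k$. $\Gamma$ is $k$-arc-transitive if $\mathrm{Aut}(\Gamma)$ acts transitively on the set of $k$-arcs; sharply $k$-arc-transitive means $k$-arc-transitive but not $(k+1)$-arc-transitive. For a digraph $\Delta$ with vertex set $V$ and a positive integer $k$, $\mathbb{Z}(\Delta,k)$ is the digraph with vertex set $\mathbb{Z}\times V^k$ in which the out-neighbours of $(i;v_0,\dots,v_{k-1})$ are the vertices $(i+1;w_0,\dots,w_{k-1})$ such that $v_j=w_j$ if $j\not\equiv i \pmod k$, and $(v_j,w_j)\in \mathrm E\Delta$ if $j\equiv i\pmod k$. $\vec K_{d}$ is the complete digraph on $d$ vertices: $(v,w)$ is an arc exactly when $v\ne w$. A digraph has two ends (is two-ended) if it (i.e. its underlying undirected graph) is connected and by removing some finite set of vertices it is possible to get two infinite components, but one never gets more than two infinite components by removing a finite set of vertices. -}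

module Defs where

open import Data.Fin.Base using (Fin; suc; toℕ; inject₁)
open import Data.Integer.Base as ℤ using (ℤ; +_; 1ℤ)
open import Data.Integer.Divisibility as ℤ using ()
open import Data.List.Base using (List; length)
open import Data.List.Membership.Propositional using (_∈_; _∉_)
open import Data.List.Relation.Unary.Unique.Propositional using (Unique)
open import Data.Nat.Base using (ℕ; suc)
open import Data.Product.Base using (∃; ∃-syntax; Σ-syntax; _×_; _,_; proj₁)
open import Data.Vec.Base using (Vec; lookup)
open import Function.Bundles using (_↔_; _⇔_; module Inverse)
open import Function.Definitions using (Injective)
open import Relation.Binary.Construct.Closure.Equivalence using (EqClosure)
open import Relation.Binary.PropositionalEquality using (_≡_; _≢_)
open import Relation.Nullary.Negation using (¬_)

-- E is a subset of V × V: only whether E u v is inhabited matters below,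
-- never how many proofs it has.
record Digraph : Set₁ where
  field
    V : Set
    E : V → V → Set

open Digraph public

HasSize : {A : Set} → (A → Set) → ℕ → Set
HasSize P n = ∃[ xs ] Unique xs × length xs ≡ n × (∀ x → x ∈ xs ⇔ P x)

Infinite : {A : Set} → (A → Set) → Set
Infinite {A} P = (xs : List A) → ∃[ x ] P x × x ∉ xs

module _ (Γ : Digraph) where

  InValency OutValency : V Γ → ℕ → Set
  InValency  v = HasSize (λ u → E Γ u v)
  OutValency v = HasSize (λ u → E Γ v u)

  Arc : ℕ → Set
  Arc k = Σ[ v ∈ (Fin (suc k) → V Γ) ]
            (∀ (i : Fin k) → E Γ (v (inject₁ i)) (v (suc i)))

  record Automorphism : Set where
    field
      bijection : V Γ ↔ V Γ
    open Inverse bijection public using (to)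
    field
      arc⇔arc : ∀ u v → E Γ u v ⇔ E Γ (to u) (to v)

  ArcTransitive : ℕ → Set
  ArcTransitive k = (a b : Arc k) →
    ∃[ φ ] (∀ i → Automorphism.to φ (proj₁ a i) ≡ proj₁ b i)

  SharplyArcTransitive : ℕ → Set
  SharplyArcTransitive k = ArcTransitive k × ¬ ArcTransitive (suc k)

  -- Connectivity in the underlying undirected graph; the component of v is
  -- the predicate Linked v.
  Linked : V Γ → V Γ → Set
  Linked = EqClosure (E Γ)

  Connected : Set
  Connected = ∀ u v → Linked u v

  -- There are at least n infinite components: c picks a vertex from each of
  -- n infinite components, distinct indices giving distinct components.
  InfiniteComponents : ℕ → Set
  InfiniteComponents n = Σ[ c ∈ (Fin n → V Γ) ]
    (∀ i → Infinite (Linked (c i))) × Injective _≡_ Linked c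

-- Proofs of v ∉ S are definitionally equal, so the vertices are exactly those
-- of Γ outside S.
_∖_ : (Γ : Digraph) → List (V Γ) → Digraph
Γ ∖ S = record
  { V = ∃[ v ] v ∉ S
  ; E = λ u v → E Γ (proj₁ u) (proj₁ v)
  }

TwoEnded : Digraph → Set
TwoEnded Γ = Connected Γ
           × (∃[ S ] InfiniteComponents (Γ ∖ S) 2)
           × (∀ S → ¬ InfiniteComponents (Γ ∖ S) 3)

_≡_[mod_] : ℤ → ℤ → ℕ → Set
i ≡ j [mod k ] = (+ k) ℤ.∣ (i ℤ.- j)

-- The digraph ℤ(Δ, k), for k positive.
Z : Digraph → ℕ → Digraph
Z Δ k = record
  { V = ℤ × Vec (V Δ) k
  ; E = λ (i , v) (i′ , w) →
        i′ ≡ i ℤ.+ 1ℤ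
      × (∀ (j : Fin k) →
            (¬ ((+ toℕ j) ≡ i [mod k ]) → lookup v j ≡ lookup w j)
          × ((+ toℕ j) ≡ i [mod k ] → E Δ (lookup v j) (lookup w j)))
  }

K⃗ : ℕ → Digraph
K⃗ n = record { V = Fin n ; E = _≢_ }

{-# OPTIONS --safe #-}
module Submission where

-- Write a vertex as a level i together with a layer in V^k; an arc at level i
-- changes coordinate i mod k only. A k-arc therefore changes every coordinate
-- exactly once, so it is determined by its two ends, which are related by an arc
-- of Δ in each coordinate; shifting levels, rotating coordinates and applying
-- an automorphism of Δ in each coordinate moves any k-arc to any other. A
-- (k+1)-arc changes one coordinate twice, x → y → z, and the cases x = z and
-- x ≠ z are told apart by whether each out-neighbour of the first vertex has a
-- k-arc to the last. For the ends, zigzagging between two consecutive levels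
-- (using three values) sets a coordinate freely, so k levels disjoint from the
-- removed set suffice to link any two layers, while removing level 0 separates
-- the two sides.

open import Defs
open import Data.Bool.Base using (Bool; true; false; if_then_else_)
open import Data.Bool.Properties using (if-float)
open import Data.Empty using (⊥; ⊥-elim)
open import Data.Fin.Base using (Fin; zero; suc; toℕ; fromℕ; fromℕ<; inject₁; punchIn; punchOut)
open import Data.Fin.Induction using (<-weakInduction)
open import Data.Fin.Patterns using (0F; 1F; 2F)
open import Data.Fin.Permutation as Perm using (Permutation′; _⟨$⟩ʳ_; _∘ₚ_)
open import Data.Fin.Properties as Fin using (pigeonhole; punchIn-injective; punchInᵢ≢i; punchIn-punchOut; toℕ-fromℕ; toℕ-fromℕ<; toℕ-injective; toℕ-inject₁; toℕ<n)
open import Data.Integer.Base as ℤ using (ℤ; +_; -[1+_]; 0ℤ; 1ℤ; -≤-; +≤+)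
import Data.Integer.DivMod as ℤ
import Data.Integer.Divisibility.Signed as Signed
import Data.Integer.Properties as ℤ
open import Data.Integer.Tactic.RingSolver using (solve-∀)
open import Data.List.Base as List using (List; []; _∷_; allFin; upTo; _++_; cartesianProduct; cartesianProductWith)
open import Data.List.Extrema.Nat using (max; xs≤max)
import Data.List.Membership.DecPropositional as DecMembership
open import Data.List.Membership.Propositional using (_∈_; _∉_)
open import Data.List.Membership.Propositional.Properties using (∈-map⁺; ∈-map⁻; ∈-allFin; ∈-upTo⁺; ∈-++⁺ˡ; ∈-++⁺ʳ; ∈-cartesianProduct⁺; ∈-cartesianProductWith⁺)
open import Data.List.Properties using (length-map; length-tabulate)
import Data.List.Relation.Unary.All as All
open import Data.List.Relation.Unary.Any using (here; there)
import Data.List.Relation.Unary.Unique.Propositional.Properties as Unique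
open import Data.Nat.Base as ℕ using (ℕ; zero; suc; NonZero; _<ᵇ_; _≥_; s≤s; z≤n)
import Data.Nat.Divisibility as ℕ
import Data.Nat.Properties as ℕ
open import Data.Product.Base using (_×_; _,_; proj₁; proj₂; ∃-syntax; Σ-syntax)
import Data.Product.Properties as Product
open import Data.Vec.Base using (Vec; []; _∷_; lookup; replicate; tabulate; _[_]≔_)
open import Data.Vec.Properties using (lookup∘tabulate; tabulate∘lookup; tabulate-cong; lookup∘update; lookup∘update′; lookup-replicate; ≡-dec)
open import Function.Base using (id; _∘_)
open import Function.Bundles using (mk⇔; mk↔ₛ′; module Equivalence; module Injection; module Inverse)
open import Function.Properties.Inverse using (↔⇒↣)
import Relation.Binary.Construct.Closure.Equivalence as Eq
open import Relation.Binary.PropositionalEquality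
open import Relation.Nullary
open import Relation.Nullary.Decidable using (dec-true; dec-false)

-- Residues modulo k

module Residue (k : ℕ) .{{_ : NonZero k}} where

  mod-sym : ∀ x y → x ≡ y [mod k ] → y ≡ x [mod k ]
  mod-sym x y = subst (ℕ._∣_ k) (ℤ.∣i-j∣≡∣j-i∣ x y)

  mod-trans : ∀ x y z → x ≡ y [mod k ] → y ≡ z [mod k ] → x ≡ z [mod k ]
  mod-trans x y z p q = Signed.∣⇒∣ᵤ (subst ((+ k) Signed.∣_) (eq x y z)
    (Signed.∣m∣n⇒∣m+n {m = x ℤ.- y} {y ℤ.- z} (Signed.∣ᵤ⇒∣ p) (Signed.∣ᵤ⇒∣ q)))
    where
    eq : ∀ x y z → (x ℤ.- y) ℤ.+ (y ℤ.- z) ≡ x ℤ.- z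
    eq = solve-∀

  mod-+ʳ : ∀ x y z → x ≡ y [mod k ] → (x ℤ.+ z) ≡ (y ℤ.+ z) [mod k ]
  mod-+ʳ x y z = subst (λ w → k ℕ.∣ ℤ.∣ w ∣) (eq x y z)
    where
    eq : ∀ x y z → x ℤ.- y ≡ (x ℤ.+ z) ℤ.- (y ℤ.+ z)
    eq = solve-∀

  private
    a+b-a≡b : ∀ a b → (a ℤ.+ b) ℤ.- a ≡ b
    a+b-a≡b = solve-∀

  abstract

    -- Sealed so that division never unfolds: later facts about `coord` rest on `coord-sound` and
    -- the uniqueness of residues.
    coord : ℤ → Fin k
    coord x = fromℕ< (ℤ.n%ℕd<d x k)

    coord-sound : ∀ x → (+ toℕ (coord x)) ≡ x [mod k ]
    coord-sound x rewrite toℕ-fromℕ< (ℤ.n%ℕd<d x k) =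
      mod-sym x (+ (x ℤ.%ℕ k)) (Signed.∣⇒∣ᵤ {+ k} (Signed.divides (x ℤ./ℕ k)
        (trans (cong (ℤ._- + (x ℤ.%ℕ k)) (ℤ.a≡a%ℕn+[a/ℕn]*n x k)) (a+b-a≡b (+ (x ℤ.%ℕ k)) _))))

  -- Two residues differ by less than `k` in absolute value, and the only multiple of `k` that small
  -- is 0.
  residue-unique : ∀ i j → (+ toℕ {k} i) ≡ (+ toℕ {k} j) [mod k ] → i ≡ j
  residue-unique i j p =
    toℕ-injective (ℤ.+-injective (ℤ.i-j≡0⇒i≡j _ _ (ℤ.∣i∣≡0⇒i≡0 (small bound p))))
    where
    small : ∀ {n} → n ℕ.< k → k ℕ.∣ n → n ≡ 0
    small {zero}  _   _   = refl
    small {suc n} n<k k∣n = contradiction k∣n (ℕ.>⇒∤ n<k)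
    bound : ℤ.∣ + toℕ i ℤ.- + toℕ j ∣ ℕ.< k
    bound rewrite ℤ.m-n≡m⊖n (toℕ i) (toℕ j) =
      ℕ.≤-<-trans (ℤ.∣m⊝n∣≤m⊔n (toℕ i) (toℕ j)) (ℕ.⊔-lub (toℕ<n i) (toℕ<n j))

  coord-complete : ∀ j x → (+ toℕ j) ≡ x [mod k ] → coord x ≡ j
  coord-complete j x p = residue-unique (coord x) j
    (mod-trans (+ toℕ (coord x)) x (+ toℕ j) (coord-sound x) (mod-sym (+ toℕ j) x p))

  coord-toℕ : ∀ j → coord (+ toℕ j) ≡ j
  coord-toℕ j = coord-complete j (+ toℕ j)
    (Signed.∣⇒∣ᵤ {+ k} (Signed.divides 0ℤ (ℤ.+-inverseʳ (+ toℕ j))))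

  infixl 6 _⊞_

  -- The action of ℤ on coordinates by rotation, with `Fin k` read as ℤ/k.
  _⊞_ : Fin k → ℤ → Fin k
  j ⊞ t = coord (+ toℕ j ℤ.+ t)

  coord-⊞ : ∀ x t → coord x ⊞ t ≡ coord (x ℤ.+ t)
  coord-⊞ x t = sym (coord-complete (coord x ⊞ t) (x ℤ.+ t)
    (mod-trans (+ toℕ (coord x ⊞ t)) (+ toℕ (coord x) ℤ.+ t) (x ℤ.+ t)
      (coord-sound (+ toℕ (coord x) ℤ.+ t))
      (mod-+ʳ (+ toℕ (coord x)) x t (coord-sound x))))

  ⊞-assoc : ∀ j s t → j ⊞ s ⊞ t ≡ j ⊞ (s ℤ.+ t)
  ⊞-assoc j s t = trans (coord-⊞ (+ toℕ j ℤ.+ s) t) (cong coord (ℤ.+-assoc (+ toℕ j) s t))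

  ⊞-identityʳ : ∀ j → j ⊞ 0ℤ ≡ j
  ⊞-identityʳ j = trans (cong coord (ℤ.+-identityʳ (+ toℕ j))) (coord-toℕ j)

  ⊞-cancel : ∀ j s t → s ℤ.+ t ≡ 0ℤ → j ⊞ s ⊞ t ≡ j
  ⊞-cancel j s t eq = trans (⊞-assoc j s t) (trans (cong (j ⊞_) eq) (⊞-identityʳ j))

  -- The step at which coordinate j changes along an arc starting at level i.
  offset : ℤ → Fin k → Fin k
  offset i j = j ⊞ (ℤ.- i)

  -- With `offset-coord`, this makes `offset i` inverse to counting steps from level `i`: `k`
  -- consecutive steps change each coordinate exactly once.
  coord-offset : ∀ i j → coord (i ℤ.+ + toℕ (offset i j)) ≡ j
  coord-offset i j = trans (cong coord (ℤ.+-comm i (+ toℕ (offset i j))))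
    (⊞-cancel j (ℤ.- i) i (ℤ.+-inverseˡ i))

  offset-coord : ∀ i m → offset i (coord (i ℤ.+ + toℕ m)) ≡ m
  offset-coord i m = trans (coord-⊞ (i ℤ.+ + toℕ m) (ℤ.- i))
    (trans (cong coord (a+b-a≡b i (+ toℕ m))) (coord-toℕ m))

  -- Rotating a coordinate back by `t` has the same effect as starting `t` levels later; hence
  -- translations preserve interpolations.
  offset-translate : ∀ i t j → offset i (j ⊞ (ℤ.- t)) ≡ offset (i ℤ.+ t) j
  offset-translate i t j = trans (⊞-assoc j (ℤ.- t) (ℤ.- i)) (cong (j ⊞_) (eq i t))
    where
    eq : ∀ i t → ℤ.- t ℤ.+ ℤ.- i ≡ ℤ.- (i ℤ.+ t)
    eq = solve-∀

-- Arcs and automorphisms of ℤ(Δ, k)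

lookup-ext : ∀ {A : Set} {n} {v w : Vec A n} → (∀ j → lookup v j ≡ lookup w j) → v ≡ w
lookup-ext {v = v} {w} p =
  trans (sym (tabulate∘lookup v)) (trans (tabulate-cong p) (tabulate∘lookup w))

<ᵇ-true : ∀ {m n} → m ℕ.< n → (m <ᵇ n) ≡ true
<ᵇ-true {zero}  (ℕ.s≤s _) = refl
<ᵇ-true {suc m} (ℕ.s≤s p) = <ᵇ-true p

n<ᵇn : ∀ n → (n <ᵇ n) ≡ false
n<ᵇn zero    = refl
n<ᵇn (suc n) = n<ᵇn n

-- This is why one step of an interpolation leaves every coordinate but one unchanged.
<ᵇ-suc : ∀ m n → m ≢ n → (m <ᵇ suc n) ≡ (m <ᵇ n)
<ᵇ-suc zero    zero    m≢n = ⊥-elim (m≢n refl)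
<ᵇ-suc zero    (suc n) m≢n = refl
<ᵇ-suc (suc m) zero    m≢n = refl
<ᵇ-suc (suc m) (suc n) m≢n = <ᵇ-suc m n (m≢n ∘ cong suc)

module _ (Γ : Digraph) where

  -- The ends are pinned by propositional equations, since those of an interpolated arc do not
  -- compute to the intended vertices.
  record Reach (n : ℕ) (x y : V Γ) : Set where
    constructor reach
    field
      arc   : Arc Γ n
      start : proj₁ arc zero ≡ x
      end   : proj₁ arc (fromℕ n) ≡ y

module _ {Γ : Digraph} where

  reach-edge : ∀ {x y} → E Γ x y → Reach Γ 1 x y
  reach-edge {x} {y} e = reach ((λ { zero → x ; (suc zero) → y }) , λ { zero → e }) refl refl

  reach-cons : ∀ {n x y z} → E Γ x y → Reach Γ n y z → Reach Γ (suc n) x z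
  reach-cons {n} {x} e (reach (a , a→) start end) =
    reach (b , λ { zero → subst (E Γ x) (sym start) e ; (suc m) → a→ m }) refl end
    where
    b : Fin (suc (suc n)) → V Γ
    b zero    = x
    b (suc m) = a m

  reach-map : ∀ (φ : Automorphism Γ) {n x y} → Reach Γ n x y →
              Reach Γ n (Automorphism.to φ x) (Automorphism.to φ y)
  reach-map φ (reach (a , a→) start end) =
    reach (to ∘ a , λ m → Equivalence.to (arc⇔arc _ _) (a→ m)) (cong to start) (cong to end)
    where open Automorphism φ

  -- Forgets the interior vertices: both uses, in `Δ` with `n` = 1 and in `Γ` with `n` = k + 1, need
  -- only the images of the ends.
  reach-transitive : ∀ {n} → ArcTransitive Γ n → ∀ {x y x′ y′} → Reach Γ n x y → Reach Γ n x′ y′ →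
    Σ[ φ ∈ Automorphism Γ ] Automorphism.to φ x ≡ x′ × Automorphism.to φ y ≡ y′
  reach-transitive {n} transitive (reach a start end) (reach b start′ end′) =
    φ , trans (cong to (sym start)) (trans (φa≡b zero) start′)
      , trans (cong to (sym end)) (trans (φa≡b (fromℕ n)) end′)
    where
    φ∃ : ∃[ φ ] (∀ i → Automorphism.to φ (proj₁ a i) ≡ proj₁ b i)
    φ∃ = transitive a b
    φ : Automorphism Γ
    φ = proj₁ φ∃
    φa≡b : ∀ i → Automorphism.to φ (proj₁ a i) ≡ proj₁ b i
    φa≡b = proj₂ φ∃
    open Automorphism φ

module Layered (Δ : Digraph) (k : ℕ) .{{_ : NonZero k}} where

  open Residue k

  Γ : Digraph
  Γ = Z Δ k

  Layer : Set
  Layer = Vec (V Δ) k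

  -- The arc relation with its congruences replaced by comparison with the single coordinate
  -- `coord i`.
  record Step (i : ℤ) (v w : Layer) : Set where
    constructor step
    field
      stay : ∀ j → coord i ≢ j → lookup v j ≡ lookup w j
      move : E Δ (lookup v (coord i)) (lookup w (coord i))

  open Step

  step⇒E : ∀ i v w → Step i v w → E Γ (i , v) (i ℤ.+ 1ℤ , w)
  step⇒E i v w s = refl , λ j →
      (λ j≢i → stay s j λ { refl → j≢i (coord-sound i) })
    , (λ j≡i → subst (λ c → E Δ (lookup v c) (lookup w c)) (coord-complete j i j≡i) (move s))

  E⇒step : ∀ x y → E Γ x y → Step (proj₁ x) (proj₂ x) (proj₂ y)
  E⇒step (i , _) _ (_ , e) = step
    (λ j i≢j → proj₁ (e j) (i≢j ∘ coord-complete j i))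
    (proj₂ (e (coord i)) (coord-sound i))

  step-update : ∀ i v {a} → E Δ (lookup v (coord i)) a → Step i v (v [ coord i ]≔ a)
  step-update i v {a} e = step
    (λ j i≢j → sym (lookup∘update′ (i≢j ∘ sym) v a))
    (subst (E Δ _) (sym (lookup∘update (coord i) v a)) e)

  step-update⁻ : ∀ i v {a} → E Δ a (lookup v (coord i)) → Step i (v [ coord i ]≔ a) v
  step-update⁻ i v {a} e = step
    (λ j i≢j → lookup∘update′ (i≢j ∘ sym) v a)
    (subst (λ b → E Δ b _) (sym (lookup∘update (coord i) v a)) e)

  update-stay : ∀ i {v w : Layer} → (∀ j → coord i ≢ j → lookup v j ≡ lookup w j) →
                w ≡ v [ coord i ]≔ lookup w (coord i)
  update-stay i {v} {w} p = lookup-ext λ j → case j (coord i Fin.≟ j)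
    where
    case : ∀ j → Dec (coord i ≡ j) → lookup w j ≡ lookup (v [ coord i ]≔ lookup w (coord i)) j
    case j (yes refl) = sym (lookup∘update (coord i) v _)
    case j (no i≢j)   = trans (sym (p j i≢j)) (sym (lookup∘update′ (i≢j ∘ sym) v _))

  update-injective : ∀ (c : Fin k) (v : Layer) {a b} → (v [ c ]≔ a) ≡ (v [ c ]≔ b) → a ≡ b
  update-injective c v {a} {b} p =
    trans (sym (lookup∘update c v a)) (trans (cong (λ u → lookup u c) p) (lookup∘update c v b))

  -- Valencies of ℤ(Δ, k)

  module _ {d : ℕ} where

    -- An out-neighbour is determined by its new value at `coord i`, so the list of out-neighbours
    -- in `Δ` carries over along an injective map.
    outValency : (∀ x → OutValency Δ x d) → ∀ v → OutValency Γ v d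
    outValency out (i , v) with out (lookup v (coord i))
    ... | xs , unique , len , x∈xs⇔E =
      List.map next xs
      , Unique.map⁺ (update-injective (coord i) v ∘ cong proj₂) unique
      , trans (length-map next xs) len
      , λ y → mk⇔ (to y) (from y)
      where
      next : V Δ → V Γ
      next a = i ℤ.+ 1ℤ , v [ coord i ]≔ a
      to : ∀ y → y ∈ List.map next xs → E Γ (i , v) y
      to y y∈ with ∈-map⁻ next y∈
      ... | a , a∈xs , refl = step⇒E _ _ _ (step-update i v (Equivalence.to (x∈xs⇔E a) a∈xs))
      from : ∀ y → E Γ (i , v) y → y ∈ List.map next xs
      from y@(_ , w) e@(refl , _) =
        subst (λ u → (i ℤ.+ 1ℤ , u) ∈ List.map next xs) (sym (update-stay i (stay s)))
          (∈-map⁺ next (Equivalence.from (x∈xs⇔E (lookup w (coord i))) (move s)))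
        where
        s : Step i v w
        s = E⇒step (i , v) y e

    inValency : (∀ x → InValency Δ x d) → ∀ v → InValency Γ v d
    inValency inn (i , v) with inn (lookup v (coord (i ℤ.- 1ℤ)))
    ... | xs , unique , len , x∈xs⇔E =
      List.map next xs
      , Unique.map⁺ (update-injective (coord i′) v ∘ cong proj₂) unique
      , trans (length-map next xs) len
      , λ y → mk⇔ (to y) (from y)
      where
      -- Arcs into level `i` start one level lower and change the coordinate belonging to that lower
      -- level.
      i′ : ℤ
      i′ = i ℤ.- 1ℤ
      next : V Δ → V Γ
      next a = i′ , v [ coord i′ ]≔ a
      i′+1≡i : ∀ i → (i ℤ.- 1ℤ) ℤ.+ 1ℤ ≡ i
      i′+1≡i = solve-∀
      i+1-1≡i : ∀ i → (i ℤ.+ 1ℤ) ℤ.- 1ℤ ≡ i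
      i+1-1≡i = solve-∀
      to : ∀ y → y ∈ List.map next xs → E Γ y (i , v)
      to y y∈ with ∈-map⁻ next y∈
      ... | a , a∈xs , refl = subst (λ l → E Γ (next a) (l , v)) (i′+1≡i i)
        (step⇒E _ _ _ (step-update⁻ i′ v (Equivalence.to (x∈xs⇔E a) a∈xs)))
      from : ∀ y → E Γ y (i , v) → y ∈ List.map next xs
      -- The level `l` is passed on as a variable so that its equation with `i′` can be matched.
      from (l , w) e = from′ l e (trans (sym (i+1-1≡i l)) (cong (ℤ._- 1ℤ) (sym (proj₁ e))))
        where
        from′ : ∀ l → E Γ (l , w) (i , v) → l ≡ i′ → (l , w) ∈ List.map next xs
        from′ _ e refl =
          subst (λ u → (i′ , u) ∈ List.map next xs)
            (sym (update-stay i′ λ j i′≢j → sym (stay s j i′≢j)))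
            (∈-map⁺ next (Equivalence.from (x∈xs⇔E (lookup w (coord i′))) (move s)))
          where
          s : Step i′ w v
          s = E⇒step (i′ , w) (i , v) e

  -- Every k-arc of Γ has this form, for m = 0, …, k.
  interpolate : ℤ → Layer → Layer → ℕ → V Γ
  interpolate i v w m =
    i ℤ.+ + m , tabulate λ j → if toℕ (offset i j) <ᵇ m then lookup w j else lookup v j

  lookup-interpolate : ∀ i v w m j → lookup (proj₂ (interpolate i v w m)) j ≡
    (if toℕ (offset i j) <ᵇ m then lookup w j else lookup v j)
  lookup-interpolate i v w m = lookup∘tabulate _

  -- The coordinate changed at level `i` + `m` has offset `m`; it alone flips its comparison when
  -- the bound grows from `m` to `m` + 1.
  interpolate-step : ∀ i v w → (∀ j → E Δ (lookup v j) (lookup w j)) → ∀ (m : Fin k) →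
    E Γ (interpolate i v w (toℕ m)) (interpolate i v w (suc (toℕ m)))
  interpolate-step i v w v→w m =
    subst (λ l → E Γ x (l , proj₂ y)) (eq i (+ toℕ m)) (step⇒E (i ℤ.+ + toℕ m) (proj₂ x) (proj₂ y) (step stays moves))
    where
    x y : V Γ
    x = interpolate i v w (toℕ m)
    y = interpolate i v w (suc (toℕ m))
    c : Fin k
    c = coord (i ℤ.+ + toℕ m)
    eq : ∀ i m → (i ℤ.+ m) ℤ.+ 1ℤ ≡ i ℤ.+ (1ℤ ℤ.+ m)
    eq = solve-∀
    stays : ∀ j → c ≢ j → lookup (proj₂ x) j ≡ lookup (proj₂ y) j
    stays j c≢j = trans (lookup-interpolate i v w (toℕ m) j) (trans
      (cong (if_then lookup w j else lookup v j) (sym (<ᵇ-suc _ (toℕ m) λ o≡m →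
        c≢j (trans (cong (λ n → coord (i ℤ.+ + n)) (sym o≡m)) (coord-offset i j)))))
      (sym (lookup-interpolate i v w (suc (toℕ m)) j)))
    before : lookup (proj₂ x) c ≡ lookup v c
    before = trans (lookup-interpolate i v w (toℕ m) c)
      (cong (if_then lookup w c else lookup v c)
        (trans (cong (λ o → toℕ o <ᵇ toℕ m) (offset-coord i m)) (n<ᵇn (toℕ m))))
    after : lookup (proj₂ y) c ≡ lookup w c
    after = trans (lookup-interpolate i v w (suc (toℕ m)) c)
      (cong (if_then lookup w c else lookup v c)
        (trans (cong (λ o → toℕ o <ᵇ suc (toℕ m)) (offset-coord i m)) (<ᵇ-true (ℕ.n<1+n (toℕ m)))))
    moves : E Δ (lookup (proj₂ x) c) (lookup (proj₂ y) c)
    moves = subst₂ (E Δ) (sym before) (sym after) (v→w c)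

  arc-level : ∀ {n} (a : Arc Γ n) m → proj₁ (proj₁ a m) ≡ proj₁ (proj₁ a zero) ℤ.+ + toℕ m
  arc-level (a , a→) = <-weakInduction _ (sym (ℤ.+-identityʳ _)) λ m ih →
    trans (proj₁ (a→ m)) (trans (cong (ℤ._+ 1ℤ) ih)
      (trans (cong (λ n → (proj₁ (a zero) ℤ.+ + n) ℤ.+ 1ℤ) (toℕ-inject₁ m)) (eq (proj₁ (a zero)) (+ toℕ m))))
    where
    eq : ∀ i m → (i ℤ.+ m) ℤ.+ 1ℤ ≡ i ℤ.+ (1ℤ ℤ.+ m)
    eq = solve-∀

  module _ (arc : Arc Γ k) where

    private
      a : Fin (suc k) → V Γ
      a = proj₁ arc
      i : ℤ
      i = proj₁ (a zero)
      at : Fin (suc k) → Fin k → V Δ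
      at m = lookup (proj₂ (a m))

    arc-step : ∀ m → Step (i ℤ.+ + toℕ m) (proj₂ (a (inject₁ m))) (proj₂ (a (suc m)))
    arc-step m = subst (λ l → Step l (proj₂ (a (inject₁ m))) (proj₂ (a (suc m))))
      (trans (arc-level arc (inject₁ m)) (cong (λ n → i ℤ.+ + n) (toℕ-inject₁ m)))
      (E⇒step (a (inject₁ m)) (a (suc m)) (proj₂ arc m))

    private
      -- Induction on `m`: coordinate `j` keeps its value at every step other than step
      -- `offset i j`.
      profile : ∀ j m → at m j ≡
        (if toℕ (offset i j) <ᵇ toℕ m then at (suc (offset i j)) j else at zero j)
      profile j = <-weakInduction _ refl λ m ih → go m ih (offset i j Fin.≟ m)
        where
        o : Fin k
        o = offset i j
        mix : Bool → V Δ
        mix = if_then at (suc o) j else at zero j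
        go : ∀ m → at (inject₁ m) j ≡ mix (toℕ o <ᵇ toℕ (inject₁ m)) → Dec (o ≡ m) →
             at (suc m) j ≡ mix (toℕ o <ᵇ suc (toℕ m))
        go m ih (yes refl) = cong mix (sym (<ᵇ-true (ℕ.n<1+n (toℕ o))))
        go m ih (no o≢m)   = trans
          (sym (stay (arc-step m) j λ c≡j → o≢m (trans (cong (offset i) (sym c≡j)) (offset-coord i m))))
          (trans ih (cong mix (trans (cong (toℕ o <ᵇ_) (toℕ-inject₁ m))
            (sym (<ᵇ-suc (toℕ o) (toℕ m) (o≢m ∘ toℕ-injective))))))

      -- Every offset is below `k`, so by the end of the arc each coordinate has taken its new
      -- value.
      last : ∀ j → at (suc (offset i j)) j ≡ at (fromℕ k) j
      last j = sym (trans (profile j (fromℕ k)) (cong (if_then at (suc (offset i j)) j else at zero j)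
        (<ᵇ-true (subst (toℕ (offset i j) ℕ.<_) (sym (toℕ-fromℕ k)) (toℕ<n (offset i j))))))

    arc-interpolates : ∀ m → a m ≡ interpolate i (proj₂ (a zero)) (proj₂ (a (fromℕ k))) (toℕ m)
    arc-interpolates m = cong₂ _,_ (arc-level arc m) (lookup-ext λ j →
      trans (profile j m) (trans (cong (λ x → if toℕ (offset i j) <ᵇ toℕ m then x else at zero j) (last j))
        (sym (lookup∘tabulate _ j))))

    -- The arc of `Δ` is the one traversed at step `offset i j`: until then coordinate `j` has its
    -- initial value, afterwards its final one.
    arc-ends : ∀ j → E Δ (at zero j) (at (fromℕ k) j)
    arc-ends j = subst₂ (E Δ) before (last j)
      (subst (λ c → E Δ (at (inject₁ o) c) (at (suc o) c)) (coord-offset i j) (move (arc-step o)))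
      where
      o : Fin k
      o = offset i j
      before : at (inject₁ o) j ≡ at zero j
      before = trans (profile j (inject₁ o)) (cong (if_then at (suc o) j else at zero j)
        (trans (cong (toℕ o <ᵇ_) (toℕ-inject₁ o)) (n<ᵇn (toℕ o))))

  -- Together with `reach⁻`: vertices `k` levels apart are joined by a k-arc exactly when their
  -- layers are adjacent in every coordinate.
  reach⁺ : ∀ i v w → (∀ j → E Δ (lookup v j) (lookup w j)) → Reach Γ k (i , v) (i ℤ.+ + k , w)
  reach⁺ i v w v→w = record
    { arc   = interpolate i v w ∘ toℕ
            , λ m → subst (λ n → E Γ (interpolate i v w n) (interpolate i v w (suc (toℕ m))))
                (sym (toℕ-inject₁ m)) (interpolate-step i v w v→w m)
    ; start = cong₂ _,_ (ℤ.+-identityʳ i) (tabulate∘lookup v)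
    ; end   = cong₂ _,_ (cong (λ n → i ℤ.+ + n) (toℕ-fromℕ k)) (lookup-ext λ j →
                trans (lookup-interpolate i v w (toℕ (fromℕ k)) j)
                  (cong (if_then lookup w j else lookup v j)
                    (<ᵇ-true (subst (toℕ (offset i j) ℕ.<_) (sym (toℕ-fromℕ k)) (toℕ<n (offset i j))))))
    }

  reach⁻ : ∀ {x y} → Reach Γ k x y → ∀ j → E Δ (lookup (proj₂ x) j) (lookup (proj₂ y) j)
  reach⁻ (reach arc start end) j =
    subst₂ (λ x y → E Δ (lookup (proj₂ x) j) (lookup (proj₂ y) j)) start end (arc-ends arc j)

  -- Automorphisms of ℤ(Δ, k)

  translate : ℤ → (Fin k → V Δ → V Δ) → V Γ → V Γ
  translate t f (l , u) = l ℤ.+ t , tabulate λ j → f j (lookup u (j ⊞ (ℤ.- t)))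

  lookup-translate : ∀ t f x j → lookup (proj₂ (translate t f x)) j ≡ f j (lookup (proj₂ x) (j ⊞ (ℤ.- t)))
  lookup-translate t f x = lookup∘tabulate _

  -- The rotation makes up for the shift: the coordinate changed at level `l` lands in the position
  -- changed at level `l` + `t`.
  translate-E : ∀ t f → (∀ j a b → E Δ a b → E Δ (f j a) (f j b)) →
                ∀ x y → E Γ x y → E Γ (translate t f x) (translate t f y)
  translate-E t f f-E x@(l , u) y@(l′ , u′) e =
    subst (λ m → E Γ (translate t f x) (m , proj₂ (translate t f y)))
      (trans (eq l t) (cong (ℤ._+ t) (sym (proj₁ e))))
      (step⇒E (l ℤ.+ t) (proj₂ (translate t f x)) (proj₂ (translate t f y)) (step stays moves))
    where
    s : Step l u u′
    s = E⇒step x y e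
    c : Fin k
    c = coord (l ℤ.+ t)
    eq : ∀ l t → (l ℤ.+ t) ℤ.+ 1ℤ ≡ (l ℤ.+ 1ℤ) ℤ.+ t
    eq = solve-∀
    back : c ⊞ (ℤ.- t) ≡ coord l
    back = trans (coord-⊞ (l ℤ.+ t) (ℤ.- t)) (cong coord (i+t-t≡i l t))
      where
      i+t-t≡i : ∀ l t → (l ℤ.+ t) ℤ.- t ≡ l
      i+t-t≡i = solve-∀
    stays : ∀ j → c ≢ j → lookup (proj₂ (translate t f x)) j ≡ lookup (proj₂ (translate t f y)) j
    stays j c≢j = trans (lookup-translate t f x j) (trans
      (cong (f j) (stay s (j ⊞ (ℤ.- t)) λ p → c≢j
        (trans (sym (coord-⊞ l t)) (trans (cong (_⊞ t) p) (⊞-cancel j (ℤ.- t) t (ℤ.+-inverseˡ t))))))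
      (sym (lookup-translate t f y j)))
    moves : E Δ (lookup (proj₂ (translate t f x)) c) (lookup (proj₂ (translate t f y)) c)
    moves = subst₂ (E Δ) (sym (lookup-translate t f x c)) (sym (lookup-translate t f y c))
      (f-E c _ _ (subst (λ j → E Δ (lookup u j) (lookup u′ j)) (sym back) (move s)))

  -- Kept general in the two families of maps so that it yields both inverse laws of `translation`.
  translate-∘ : ∀ s t f g → s ℤ.+ t ≡ 0ℤ → (∀ j a → f j (g (j ⊞ (ℤ.- s)) a) ≡ a) →
                ∀ x → translate s f (translate t g x) ≡ x
  translate-∘ s t f g s+t≡0 fg x@(l , u) = cong₂ _,_
    (trans (eq l s t) (trans (cong (λ z → l ℤ.+ z) s+t≡0) (ℤ.+-identityʳ l)))
    (lookup-ext λ j → trans (lookup-translate s f (translate t g x) j)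
      (trans (cong (f j) (lookup-translate t g x (j ⊞ (ℤ.- s))))
      (trans (fg j _) (cong (lookup u) (⊞-cancel j (ℤ.- s) (ℤ.- t)
        (trans (sym (ℤ.neg-distrib-+ s t)) (cong ℤ.-_ s+t≡0)))))))
    where
    eq : ∀ l s t → (l ℤ.+ t) ℤ.+ s ≡ l ℤ.+ (s ℤ.+ t)
    eq = solve-∀

  module _ (t : ℤ) (ψ : Fin k → Automorphism Δ) where

    private
      open module ψ j = Automorphism (ψ j) using () renaming (to to f)
      -- The inverse rotation brings the entry at `j ⊞ t` to position `j`, and that entry was
      -- produced by `ψ (j ⊞ t)`.
      g : Fin k → V Δ → V Δ
      g j = Inverse.from (Automorphism.bijection (ψ (j ⊞ t)))

      g-E : ∀ j a b → E Δ a b → E Δ (g j a) (g j b)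
      g-E j a b e = Equivalence.from (Automorphism.arc⇔arc (ψ (j ⊞ t)) _ _)
        (subst₂ (E Δ) (sym (Inverse.strictlyInverseˡ bij a)) (sym (Inverse.strictlyInverseˡ bij b)) e)
        where bij = Automorphism.bijection (ψ (j ⊞ t))

      f-E : ∀ j a b → E Δ a b → E Δ (f j a) (f j b)
      f-E j a b = Equivalence.to (Automorphism.arc⇔arc (ψ j) a b)

      f∘g : ∀ x → translate t f (translate (ℤ.- t) g x) ≡ x
      f∘g = translate-∘ t (ℤ.- t) f g (ℤ.+-inverseʳ t) λ j a →
        trans (cong (λ i → f j (Inverse.from (Automorphism.bijection (ψ i)) a))
                (⊞-cancel j (ℤ.- t) t (ℤ.+-inverseˡ t)))
          (Inverse.strictlyInverseˡ (Automorphism.bijection (ψ j)) a)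

      g∘f : ∀ x → translate (ℤ.- t) g (translate t f x) ≡ x
      g∘f = translate-∘ (ℤ.- t) t g f (ℤ.+-inverseˡ t) λ j a →
        trans (cong (λ i → g j (f i a)) (cong (j ⊞_) (ℤ.neg-involutive t)))
          (Inverse.strictlyInverseʳ (Automorphism.bijection (ψ (j ⊞ t))) a)

    translation : Automorphism Γ
    translation = record
      { bijection = mk↔ₛ′ (translate t f) (translate (ℤ.- t) g) f∘g g∘f
      ; arc⇔arc   = λ x y → mk⇔ (translate-E t f f-E x y)
          (subst₂ (E Γ) (g∘f x) (g∘f y) ∘ translate-E (ℤ.- t) g g-E (translate t f x) (translate t f y))
      }

  -- By `offset-translate` the choice between the two layers is the one made from start level `i` +
  -- `t`, so only the end layers need matching.
  translate-interpolate : ∀ i t f v w v′ w′ →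
    (∀ j → f j (lookup v (j ⊞ (ℤ.- t))) ≡ lookup v′ j) →
    (∀ j → f j (lookup w (j ⊞ (ℤ.- t))) ≡ lookup w′ j) →
    ∀ m → translate t f (interpolate i v w m) ≡ interpolate (i ℤ.+ t) v′ w′ m
  translate-interpolate i t f v w v′ w′ fv fw m = cong₂ _,_ (eq i t (+ m)) (lookup-ext λ j →
    trans (lookup-translate t f (interpolate i v w m) j)
    (trans (cong (f j) (lookup-interpolate i v w m (j ⊞ (ℤ.- t))))
    (trans (if-float (f j) (toℕ (offset i (j ⊞ (ℤ.- t))) <ᵇ m))
    (trans (cong₂ (λ a b → if toℕ (offset i (j ⊞ (ℤ.- t))) <ᵇ m then a else b) (fw j) (fv j))
    (trans (cong (λ o → if toℕ o <ᵇ m then lookup w′ j else lookup v′ j) (offset-translate i t j))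
    (sym (lookup-interpolate (i ℤ.+ t) v′ w′ m j)))))))
    where
    eq : ∀ i t m → (i ℤ.+ m) ℤ.+ t ≡ (i ℤ.+ t) ℤ.+ m
    eq = solve-∀

  -- By `arc-interpolates` only the ends matter. In each coordinate they form an arc of `Δ`, so
  -- 1-arc-transitivity of `Δ` supplies the automorphism to apply there.
  arcTransitive : ArcTransitive Δ 1 → ArcTransitive Γ k
  arcTransitive trans₁ a b = translation t ψ , λ m →
    trans (cong (translate t f) (arc-interpolates a m))
    (trans (translate-interpolate i t f v w v′ w′
             (λ j → proj₁ (proj₂ (ψ∃ j))) (λ j → proj₂ (proj₂ (ψ∃ j))) (toℕ m))
    (trans (cong (λ l → interpolate l v′ w′ (toℕ m)) (eq i i′)) (sym (arc-interpolates b m))))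
    where
    i i′ t : ℤ
    i = proj₁ (proj₁ a zero)
    i′ = proj₁ (proj₁ b zero)
    t = i′ ℤ.- i
    v w v′ w′ : Layer
    v = proj₂ (proj₁ a zero)
    w = proj₂ (proj₁ a (fromℕ k))
    v′ = proj₂ (proj₁ b zero)
    w′ = proj₂ (proj₁ b (fromℕ k))
    eq : ∀ i i′ → i ℤ.+ (i′ ℤ.- i) ≡ i′
    eq = solve-∀
    ψ∃ : ∀ j → Σ[ φ ∈ Automorphism Δ ]
      Automorphism.to φ (lookup v (j ⊞ (ℤ.- t))) ≡ lookup v′ j ×
      Automorphism.to φ (lookup w (j ⊞ (ℤ.- t))) ≡ lookup w′ j
    ψ∃ j = reach-transitive trans₁ (reach-edge (arc-ends a (j ⊞ (ℤ.- t)))) (reach-edge (arc-ends b j))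
    ψ : Fin k → Automorphism Δ
    ψ j = proj₁ (ψ∃ j)
    f : Fin k → V Δ → V Δ
    f j = Automorphism.to (ψ j)

-- Complete digraphs

-- The vertices other than `x` are the values of `punchIn x`; at least two indices are available, so
-- one of them does not give `y`.
third : ∀ {d} (x y : Fin (3 ℕ.+ d)) → ∃[ z ] z ≢ x × z ≢ y
third x y with x Fin.≟ y
... | yes refl = punchIn x zero , punchInᵢ≢i x zero , punchInᵢ≢i x zero
... | no x≢y = punchIn x z , punchInᵢ≢i x z , λ p → punchInᵢ≢i (punchOut x≢y) zero
  (punchIn-injective x z (punchOut x≢y) (trans p (sym (punchIn-punchOut x≢y))))
  where z = punchIn (punchOut x≢y) zero

K⃗-outValency : ∀ d x → OutValency (K⃗ (suc d)) x d
K⃗-outValency d x =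
  List.map (punchIn x) (allFin d)
  , Unique.map⁺ (punchIn-injective x _ _) (Unique.allFin⁺ d)
  , trans (length-map (punchIn x) (allFin d)) (length-tabulate _)
  , λ y → mk⇔ (to y) (from y)
  where
  to : ∀ y → y ∈ List.map (punchIn x) (allFin d) → x ≢ y
  to y y∈ with ∈-map⁻ (punchIn x) y∈
  ... | z , _ , refl = punchInᵢ≢i x z ∘ sym
  from : ∀ y → x ≢ y → y ∈ List.map (punchIn x) (allFin d)
  from y x≢y = subst (_∈ List.map (punchIn x) (allFin d)) (punchIn-punchOut x≢y)
    (∈-map⁺ (punchIn x) (∈-allFin (punchOut x≢y)))

K⃗-inValency : ∀ d x → InValency (K⃗ (suc d)) x d
K⃗-inValency d x with K⃗-outValency d x
... | xs , unique , len , p = xs , unique , len , λ y →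
  mk⇔ (λ y∈ → Equivalence.to (p y) y∈ ∘ sym) (λ y≢x → Equivalence.from (p y) (y≢x ∘ sym))

transpose-left : ∀ {n} (x y : Fin n) → Perm.transpose x y ⟨$⟩ʳ x ≡ y
transpose-left x y rewrite dec-true (x Fin.≟ x) refl = refl

transpose-fixes : ∀ {n} {x y z : Fin n} → z ≢ x → z ≢ y → Perm.transpose x y ⟨$⟩ʳ z ≡ z
transpose-fixes {x = x} {y} {z} z≢x z≢y
  rewrite dec-false (z Fin.≟ x) z≢x | dec-false (z Fin.≟ y) z≢y = refl

K⃗-automorphism : ∀ {n} → Permutation′ n → Automorphism (K⃗ n)
K⃗-automorphism π = record
  { bijection = π
  ; arc⇔arc   = λ u v → mk⇔ (_∘ Injection.injective (↔⇒↣ π)) (_∘ cong (π ⟨$⟩ʳ_))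
  }

K⃗-arcTransitive : ∀ n → ArcTransitive (K⃗ n) 1
K⃗-arcTransitive n (a , a→) (b , b→) = K⃗-automorphism (σ ∘ₚ τ) , λ
  { zero       → trans (cong (τ ⟨$⟩ʳ_) σx≡x′) (transpose-fixes (σy≢x′ ∘ sym) (b→ zero))
  ; (suc zero) → transpose-left y′ (b 1F)
  }
  where
  σ τ : Permutation′ n
  -- `σ` puts the first vertex right and then `τ` the second; `τ` fixes `b 0F`, which is neither of
  -- the two vertices it swaps.
  σ = Perm.transpose (a 0F) (b 0F)
  y′ : Fin n
  y′ = σ ⟨$⟩ʳ a 1F
  τ = Perm.transpose y′ (b 1F)
  σx≡x′ : σ ⟨$⟩ʳ a 0F ≡ b 0F
  σx≡x′ = transpose-left (a 0F) (b 0F)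
  σy≢x′ : y′ ≢ b 0F
  σy≢x′ p = a→ zero (Injection.injective (↔⇒↣ σ) (trans σx≡x′ (sym p)))

-- Failure of (k+1)-arc-transitivity

module NotTransitive (d k′ : ℕ) where

  private
    k : ℕ
    k = suc k′
    Δ : Digraph
    Δ = K⃗ (3 ℕ.+ d)

  open Layered Δ k
  open Residue k

  private
    source : V Γ
    source = 0ℤ , replicate k 0F

    middle : V Δ → V Γ
    middle y = 1ℤ , y ∷ replicate k′ 0F

    -- Levels 0 and `k` both change coordinate 0, so a (k+1)-arc from `source` to `target z` takes
    -- it through 0, y, `z`. The other coordinates go from 0 to 1 and do not constrain y.
    target : V Δ → V Γ
    target z = 1ℤ ℤ.+ + k , z ∷ replicate k′ 1F

    coord-0 : coord 0ℤ ≡ zero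
    coord-0 = coord-toℕ zero

    source→middle : ∀ y → y ≢ 0F → E Γ source (middle y)
    source→middle y y≢0 = step⇒E 0ℤ (replicate k 0F) (y ∷ replicate k′ 0F) (step stays
      (subst (λ c → lookup (replicate k 0F) c ≢ lookup (y ∷ replicate k′ 0F) c) (sym coord-0) (y≢0 ∘ sym)))
      where
      stays : ∀ j → coord 0ℤ ≢ j → lookup (replicate k 0F) j ≡ lookup (y ∷ replicate k′ 0F) j
      stays zero    c≢0 = ⊥-elim (c≢0 coord-0)
      stays (suc j) _   = refl

    out-source : ∀ x → E Γ source x → ∃[ y ] y ≢ 0F × x ≡ middle y
    out-source x@(_ , y ∷ u) e = y
      , subst (λ c → lookup (replicate k 0F) c ≢ lookup (y ∷ u) c) coord-0 (Step.move s) ∘ sym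
      , cong₂ _,_ (proj₁ e) (cong (y ∷_) (sym (lookup-ext λ j → Step.stay s (suc j) λ c≡ → 0≢suc (trans (sym coord-0) c≡))))
      where
      s : Step 0ℤ (replicate k 0F) (y ∷ u)
      s = E⇒step source x e
      0≢suc : ∀ {n} {j : Fin n} → zero ≢ suc j
      0≢suc ()

    middle→target : ∀ y z → y ≢ z → Reach Γ k (middle y) (target z)
    middle→target y z y≢z = reach⁺ 1ℤ (y ∷ replicate k′ 0F) (z ∷ replicate k′ 1F) λ
      { zero    → y≢z
      ; (suc j) p → 0≢1 (trans (sym (lookup-replicate j 0F)) (trans p (lookup-replicate j 1F)))
      }
      where
      0≢1 : ∀ {n} → 0F ≢ suc {suc n} 0F
      0≢1 ()

    source→target : ∀ z → 1F ≢ z → Reach Γ (suc k) source (target z)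
    -- The intermediate value 1 serves both final values, 0 and 2, used below.
    source→target z 1≢z = reach-cons (source→middle 1F λ ()) (middle→target 1F z 1≢z)

  -- Every out-neighbour of source reaches target 0 by a k-arc, whereas
  -- middle 2 does not reach target 2.
  ¬arcTransitive : ¬ ArcTransitive Γ (suc k)
  ¬arcTransitive transitive =
    reach⁻ (subst₂ (Reach Γ k) to-x to-target (reach-map φ x→target)) zero refl
    where
    φ∃ : Σ[ φ ∈ Automorphism Γ ] Automorphism.to φ source ≡ source
                               × Automorphism.to φ (target 0F) ≡ target 2F
    φ∃ = reach-transitive transitive (source→target 0F λ ()) (source→target 2F λ ())
    φ : Automorphism Γ
    φ = proj₁ φ∃
    open Automorphism φ
    to-source : to source ≡ source
    to-source = proj₁ (proj₂ φ∃)
    to-target : to (target 0F) ≡ target 2F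
    to-target = proj₂ (proj₂ φ∃)
    -- Since `φ` fixes `source`, the preimage of `middle 2F` is an out-neighbour of `source`, and so
    -- has a k-arc to `target 0F`.
    x : V Γ
    x = Inverse.from bijection (middle 2F)
    to-x : to x ≡ middle 2F
    to-x = Inverse.strictlyInverseˡ bijection (middle 2F)
    source→x : E Γ source x
    source→x = Equivalence.from (arc⇔arc source x)
      (subst₂ (E Γ) (sym to-source) (sym to-x) (source→middle 2F λ ()))
    x→target : Reach Γ k x (target 0F)
    x→target = go (out-source x source→x)
      where
      go : ∃[ y ] y ≢ 0F × x ≡ middle y → Reach Γ k x (target 0F)
      go (y , y≢0 , x≡) = subst (λ z → Reach Γ k z (target 0F)) (sym x≡) (middle→target y 0F y≢0)

-- Ends

vectors : ∀ n k → List (Vec (Fin n) k)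
vectors n zero    = [] ∷ []
vectors n (suc k) = cartesianProductWith _∷_ (allFin n) (vectors n k)

∈-vectors : ∀ {n k} (v : Vec (Fin n) k) → v ∈ vectors n k
∈-vectors []      = here refl
∈-vectors (x ∷ v) = ∈-cartesianProductWith⁺ _∷_ (∈-allFin x) (∈-vectors v)

integers : ℕ → List ℤ
-- The negative half is one shorter, as `-[1+ n ]` has absolute value `n` + 1.
integers N = List.map +_ (upTo (suc N)) ++ List.map -[1+_] (upTo N)

∈-integers : ∀ {N} l → ℤ.∣ l ∣ ℕ.≤ N → l ∈ integers N
∈-integers     (+ n)    n≤N = ∈-++⁺ˡ (∈-map⁺ +_ (∈-upTo⁺ (s≤s n≤N)))
∈-integers {N} -[1+ n ] n<N = ∈-++⁺ʳ (List.map +_ (upTo (suc N))) (∈-map⁺ -[1+_] (∈-upTo⁺ n<N))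

side : ℤ → Fin 2
side (+ _)    = 0F
side -[1+ _ ] = 1F

-- The sign changes only from -1 to 0, so no arc changes side once level 0 is removed.
side-+1 : ∀ l → l ℤ.+ 1ℤ ≢ 0ℤ → side l ≡ side (l ℤ.+ 1ℤ)
side-+1 (+ _)        _   = refl
side-+1 -[1+ zero ]  ≢0  = ⊥-elim (≢0 refl)
side-+1 -[1+ suc _ ] _   = refl

module Ends (d k : ℕ) .{{_ : NonZero k}} where

  private
    Δ : Digraph
    Δ = K⃗ (3 ℕ.+ d)

  open Layered Δ k
  open Residue k

  -- Linking vertices outside a finite set

  module _ (S : List (V Γ)) where

    Clear : ℤ → Set
    Clear l = ∀ u → (l , u) ∉ S

    private
      _~_ : V (Γ ∖ S) → V (Γ ∖ S) → Set
      _~_ = Linked (Γ ∖ S)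

      ~-sym : ∀ {x y} → x ~ y → y ~ x
      ~-sym = Eq.symmetric (E (Γ ∖ S))

      ~-trans : ∀ {x y z} → x ~ y → y ~ z → x ~ z
      ~-trans = Eq.transitive (E (Γ ∖ S))

      ~-reflexive : ∀ {x y} p q → x ≡ y → (x , p) ~ (y , q)
      ~-reflexive p q refl = Eq.reflexive (E (Γ ∖ S))

      step-linked : ∀ i v w p q → Step i v w → ((i , v) , p) ~ ((i ℤ.+ 1ℤ , w) , q)
      step-linked i v w p q s = Eq.return (step⇒E i v w s)

      -- One arc suffices if the value really changes. Both levels are assumed clear because
      -- otherwise the path visits further vertices on each.
      update-linked : ∀ i v a → Clear i → Clear (i ℤ.+ 1ℤ) →
        ∀ p q → ((i , v) , p) ~ ((i ℤ.+ 1ℤ , v [ coord i ]≔ a) , q)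
      update-linked i v a clear clear₊ p q = go (lookup v c Fin.≟ a)
        where
        c : Fin k
        c = coord i
        go : Dec (lookup v c ≡ a) → ((i , v) , p) ~ ((i ℤ.+ 1ℤ , v [ c ]≔ a) , q)
        go (no v≢a) = step-linked i v (v [ c ]≔ a) p q (step-update i v v≢a)
        -- A zigzag through two auxiliary values restores the value of the coordinate.
        go (yes v≡a) = ~-trans (step-linked i v (v [ c ]≔ b) p (clear₊ _) (step-update i v (b≢v ∘ sym)))
          (~-trans (~-sym (step-linked i (v [ c ]≔ b′) (v [ c ]≔ b) (clear _) (clear₊ _)
            (replace b′ b b′≢b)))
          (step-linked i (v [ c ]≔ b′) (v [ c ]≔ a) (clear _) q (replace b′ a λ b′≡a → b′≢v (trans b′≡a (sym v≡a)))))
          where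
          b b′ : V Δ
          b = proj₁ (third (lookup v c) (lookup v c))
          b≢v : b ≢ lookup v c
          b≢v = proj₁ (proj₂ (third (lookup v c) (lookup v c)))
          b′ = proj₁ (third (lookup v c) b)
          b′≢v : b′ ≢ lookup v c
          b′≢v = proj₁ (proj₂ (third (lookup v c) b))
          b′≢b : b′ ≢ b
          b′≢b = proj₂ (proj₂ (third (lookup v c) b))
          replace : ∀ x y → x ≢ y → Step i (v [ c ]≔ x) (v [ c ]≔ y)
          replace x y x≢y = step
            (λ j c≢j → trans (lookup∘update′ (c≢j ∘ sym) v x) (sym (lookup∘update′ (c≢j ∘ sym) v y)))
            (subst₂ _≢_ (sym (lookup∘update c v x)) (sym (lookup∘update c v y)) x≢y)

      -- Induction on the number of levels left: each step copies one coordinate from `w`, and the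
      -- coordinates that no remaining step will set must agree already.
      walk : ∀ n i l v w → l ≡ i ℤ.+ + n → (∀ m → i ℤ.≤ m → m ℤ.≤ l → Clear m) →
        (∀ j → (∀ m → m ℕ.< n → coord (i ℤ.+ + m) ≢ j) → lookup v j ≡ lookup w j) →
        ∀ p q → ((i , v) , p) ~ ((l , w) , q)
      walk zero    i l v w l≡i clear agree p q =
        ~-reflexive p q (cong₂ _,_ (sym (trans l≡i (ℤ.+-identityʳ i))) (lookup-ext λ j → agree j λ _ ()))
      walk (suc n) i l v w l≡ clear agree p q =
        ~-trans (update-linked i v (lookup w (coord i)) clear-i clear-i+1 p (clear-i+1 _))
          (walk n (i ℤ.+ 1ℤ) l (v [ coord i ]≔ lookup w (coord i)) w l≡′
            (λ m i+1≤m → clear m (ℤ.≤-trans i≤i+1 i+1≤m)) agree′ (clear-i+1 _) q)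
        where
        shift : ∀ i n → i ℤ.+ (1ℤ ℤ.+ n) ≡ (i ℤ.+ 1ℤ) ℤ.+ n
        shift = solve-∀
        l≡′ : l ≡ (i ℤ.+ 1ℤ) ℤ.+ + n
        l≡′ = trans l≡ (shift i (+ n))
        i≤i+1 : i ℤ.≤ i ℤ.+ 1ℤ
        i≤i+1 = ℤ.i≤i+j i 1ℤ
        i+1≤l : i ℤ.+ 1ℤ ℤ.≤ l
        i+1≤l = subst (i ℤ.+ 1ℤ ℤ.≤_) (sym l≡′) (ℤ.i≤i+j (i ℤ.+ 1ℤ) (+ n))
        clear-i : Clear i
        clear-i = clear i ℤ.≤-refl (ℤ.≤-trans i≤i+1 i+1≤l)
        clear-i+1 : Clear (i ℤ.+ 1ℤ)
        clear-i+1 = clear (i ℤ.+ 1ℤ) i≤i+1 i+1≤l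
        agree′ : ∀ j → (∀ m → m ℕ.< n → coord ((i ℤ.+ 1ℤ) ℤ.+ + m) ≢ j) →
                 lookup (v [ coord i ]≔ lookup w (coord i)) j ≡ lookup w j
        agree′ j avoid = go (coord i Fin.≟ j)
          where
          go : Dec (coord i ≡ j) → lookup (v [ coord i ]≔ lookup w (coord i)) j ≡ lookup w j
          go (yes c≡j) = subst (λ j → lookup (v [ coord i ]≔ lookup w (coord i)) j ≡ lookup w j) c≡j
            (lookup∘update (coord i) v (lookup w (coord i)))
          go (no c≢j)  = trans (lookup∘update′ (c≢j ∘ sym) v (lookup w (coord i))) (agree j λ
            { zero    _         → c≢j ∘ trans (cong coord (sym (ℤ.+-identityʳ i)))
            ; (suc m) (s≤s m<n) → avoid m m<n ∘ trans (cong coord (sym (shift i (+ m))))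
            })

      -- Across at least `k` levels every coordinate `j` is set at step `offset i j`, so the
      -- agreement hypothesis of `walk` is vacuous.
      span : ∀ i l v w → i ℤ.+ + k ℤ.≤ l → (∀ m → i ℤ.≤ m → m ℤ.≤ l → Clear m) →
        ∀ p q → ((i , v) , p) ~ ((l , w) , q)
      span i l v w i+k≤l clear = walk n i l v w l≡i+n clear λ j avoid →
        ⊥-elim (avoid (toℕ (offset i j)) (ℕ.<-≤-trans (Fin.toℕ<n (offset i j)) k≤n) (coord-offset i j))
        where
        n : ℕ
        n = ℤ.∣ l ℤ.- i ∣
        +n≡l-i : + n ≡ l ℤ.- i
        +n≡l-i = ℤ.0≤i⇒+∣i∣≡i (ℤ.i≤j⇒0≤j-i (ℤ.≤-trans (ℤ.i≤i+j i (+ k)) i+k≤l))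
        eq₁ : ∀ i l → l ≡ i ℤ.+ (l ℤ.- i)
        eq₁ = solve-∀
        eq₂ : ∀ i k → (i ℤ.+ k) ℤ.- i ≡ k
        eq₂ = solve-∀
        l≡i+n : l ≡ i ℤ.+ + n
        l≡i+n = trans (eq₁ i l) (cong (λ z → i ℤ.+ z) (sym +n≡l-i))
        k≤n : k ℕ.≤ n
        k≤n = ℤ.drop‿+≤+ (subst₂ ℤ._≤_ (eq₂ i (+ k)) (sym +n≡l-i) (ℤ.+-monoˡ-≤ (ℤ.- i) i+k≤l))

    -- Both vertices are linked to one vertex `k` levels above the higher of them, leaving room for
    -- `span` from each.
    linked-above : ∀ l l′ → (∀ m → l ℤ.≤ m → Clear m) → (∀ m → l′ ℤ.≤ m → Clear m) →
      ∀ v v′ p q → ((l , v) , p) ~ ((l′ , v′) , q)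
    linked-above l l′ clear clear′ v v′ p q = ~-trans
      (span l t v v (ℤ.+-monoˡ-≤ (+ k) (ℤ.i≤i⊔j l l′)) (λ m l≤m _ → clear m l≤m) p (clear-t v))
      (~-sym (span l′ t v′ v (ℤ.+-monoˡ-≤ (+ k) (ℤ.i≤j⊔i l l′)) (λ m l′≤m _ → clear′ m l′≤m) q (clear-t v)))
      where
      t : ℤ
      t = (l ℤ.⊔ l′) ℤ.+ + k
      clear-t : Clear t
      clear-t = clear t (ℤ.≤-trans (ℤ.i≤i⊔j l l′) (ℤ.i≤i+j (l ℤ.⊔ l′) (+ k)))

    linked-below : ∀ l l′ → (∀ m → m ℤ.≤ l → Clear m) → (∀ m → m ℤ.≤ l′ → Clear m) →
      ∀ v v′ p q → ((l , v) , p) ~ ((l′ , v′) , q)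
    linked-below l l′ clear clear′ v v′ p q = ~-trans
      (~-sym (span b l v v (subst (ℤ._≤ l) (sym b+k≡) (ℤ.i⊓j≤i l l′)) (λ m _ → clear m) (clear-b v) p))
      (span b l′ v v′ (subst (ℤ._≤ l′) (sym b+k≡) (ℤ.i⊓j≤j l l′)) (λ m _ → clear′ m) (clear-b v) q)
      where
      b : ℤ
      b = (l ℤ.⊓ l′) ℤ.- + k
      eq : ∀ x k → (x ℤ.- k) ℤ.+ k ≡ x
      eq = solve-∀
      b+k≡ : b ℤ.+ + k ≡ l ℤ.⊓ l′
      b+k≡ = eq (l ℤ.⊓ l′) (+ k)
      clear-b : Clear b
      clear-b = clear b (ℤ.≤-trans (ℤ.i≤i+j b (+ k)) (subst (ℤ._≤ l) (sym b+k≡) (ℤ.i⊓j≤i l l′)))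

    -- Past `N`, all levels further out in the same direction are clear too; mixed signs are
    -- excluded by the equation of sides.
    linked-same-side : ∀ N → (∀ m → N ℕ.< ℤ.∣ m ∣ → Clear m) →
      ∀ l l′ → N ℕ.< ℤ.∣ l ∣ → N ℕ.< ℤ.∣ l′ ∣ → side l ≡ side l′ →
      ∀ v v′ p q → ((l , v) , p) ~ ((l′ , v′) , q)
    linked-same-side N clear (+ a)    (+ b)    N<a N<b _ = linked-above (+ a) (+ b) (up a N<a) (up b N<b)
      where
      up : ∀ a → N ℕ.< a → ∀ m → + a ℤ.≤ m → Clear m
      up a N<a (+ m) (+≤+ a≤m) = clear (+ m) (ℕ.<-≤-trans N<a a≤m)
    linked-same-side N clear -[1+ a ] -[1+ b ] N<a N<b _ = linked-below -[1+ a ] -[1+ b ] (down a N<a) (down b N<b)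
      where
      down : ∀ a → N ℕ.< suc a → ∀ m → m ℤ.≤ -[1+ a ] → Clear m
      down a N<a -[1+ m ] (-≤- a≤m) = clear -[1+ m ] (ℕ.<-≤-trans N<a (s≤s a≤m))

  connected : Connected Γ
  connected (l , v) (l′ , v′) = Eq.gmap proj₁ id
    -- With nothing removed every level is clear.
    (linked-below [] l l′ (λ _ _ _ ()) (λ _ _ _ ()) v v′ (λ ()) (λ ()))

  -- At most two infinite components

  height : List (V Γ) → ℕ
  height xs = max 0 (List.map (ℤ.∣_∣ ∘ proj₁) xs)

  ≤-height : ∀ {x} xs → x ∈ xs → ℤ.∣ proj₁ x ∣ ℕ.≤ height xs
  ≤-height xs x∈xs = All.lookup (xs≤max 0 (List.map (ℤ.∣_∣ ∘ proj₁) xs)) (∈-map⁺ (ℤ.∣_∣ ∘ proj₁) x∈xs)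

  _≟V_ : (x y : V Γ) → Dec (x ≡ y)
  _≟V_ = Product.≡-dec ℤ._≟_ (≡-dec Fin._≟_)

  open DecMembership _≟V_ using (_∈?_)

  -- Infinitude of a component is tested against lists of vertices of `Γ ∖ S`, so lists of vertices
  -- of `Γ` have to be brought there.
  outside : (S : List (V Γ)) → List (V Γ) → List (V (Γ ∖ S))
  outside S []       = []
  outside S (x ∷ xs) with x ∈? S
  ... | yes _   = outside S xs
  ... | no  x∉S = (x , x∉S) ∷ outside S xs

  ∈-outside : ∀ S xs {x} → x ∈ xs → (x∉S : x ∉ S) → (x , x∉S) ∈ outside S xs
  ∈-outside S (y ∷ xs) x∈ x∉S with y ∈? S
  ∈-outside S (y ∷ xs) (here refl) x∉S | yes x∈S = ⊥-elim (x∉S x∈S)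
  ∈-outside S (y ∷ xs) (there x∈)  x∉S | yes _   = ∈-outside S xs x∈ x∉S
  -- The stored proof of non-membership and the given one are definitionally equal.
  ∈-outside S (y ∷ xs) (here refl) x∉S | no _    = here refl
  ∈-outside S (y ∷ xs) (there x∈)  x∉S | no _    = there (∈-outside S xs x∈ x∉S)

  box : ℕ → List (V Γ)
  box N = cartesianProduct (integers N) (vectors (3 ℕ.+ d) k)

  ∈-box : ∀ N x → ℤ.∣ proj₁ x ∣ ℕ.≤ N → x ∈ box N
  ∈-box N (l , v) ≤N = ∈-cartesianProduct⁺ (∈-integers l ≤N) (∈-vectors v)

  -- Each infinite component leaves the finite box containing `S`. Two of three such far vertices
  -- lie on the same side and are therefore linked.
  atMostTwoEnds : ∀ S → ¬ InfiniteComponents (Γ ∖ S) 3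
  atMostTwoEnds S (c , infinite , injective) = absurd (pigeonhole (s≤s (s≤s (s≤s z≤n))) (side ∘ level))
    where
    N : ℕ
    N = height S
    far : ∀ i → ∃[ x ] Linked (Γ ∖ S) (c i) x × x ∉ outside S (box N)
    far i = infinite i (outside S (box N))
    x : Fin 3 → V (Γ ∖ S)
    x i = proj₁ (far i)
    level : Fin 3 → ℤ
    level i = proj₁ (proj₁ (x i))
    N<level : ∀ i → N ℕ.< ℤ.∣ level i ∣
    N<level i = ℕ.≰⇒> λ ≤N → proj₂ (proj₂ (far i))
      (∈-outside S (box N) (∈-box N (proj₁ (x i)) ≤N) (proj₂ (x i)))
    clear : ∀ m → N ℕ.< ℤ.∣ m ∣ → Clear S m
    clear m N<m u mu∈S = ℕ.<⇒≱ N<m (≤-height S mu∈S)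
    absurd : ∃[ i ] ∃[ j ] (toℕ i ℕ.< toℕ j × side (level i) ≡ side (level j)) → ⊥
    absurd (i , j , i<j , eq) = Fin.<⇒≢ i<j (injective
      (Eq.transitive _ (proj₁ (proj₂ (far i)))
      (Eq.transitive _ (linked-same-side S N clear (level i) (level j) (N<level i) (N<level j) eq
                          (proj₂ (proj₁ (x i))) (proj₂ (proj₁ (x j))) (proj₂ (x i)) (proj₂ (x j)))
      (Eq.symmetric _ (proj₁ (proj₂ (far j)))))))

  -- Two infinite components after removing level 0

  private
    wall : List (V Γ)
    wall = List.map (0ℤ ,_) (vectors (3 ℕ.+ d) k)

    ∈-wall⁻ : ∀ {l u} → (l , u) ∈ wall → l ≡ 0ℤ
    ∈-wall⁻ p = cong proj₁ (proj₂ (proj₂ (∈-map⁻ (0ℤ ,_) p)))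

    ∈-wall⁺ : ∀ {l u} → l ≡ 0ℤ → (l , u) ∈ wall
    ∈-wall⁺ {u = u} refl = ∈-map⁺ (0ℤ ,_) (∈-vectors u)

    clear : ∀ m → 0 ℕ.< ℤ.∣ m ∣ → Clear wall m
    clear m 0<m u p = ℕ.<⇒≢ 0<m (sym (cong ℤ.∣_∣ (∈-wall⁻ p)))

    -- The successor keeps both families off level 0 and gives them equal absolute values.
    beside : Fin 2 → ℕ → ℤ
    beside 0F n = + suc n
    beside 1F n = -[1+ n ]

    ∣beside∣ : ∀ i n → ℤ.∣ beside i n ∣ ≡ suc n
    ∣beside∣ 0F n = refl
    ∣beside∣ 1F n = refl

    side-beside : ∀ i n → side (beside i n) ≡ i
    side-beside 0F n = refl
    side-beside 1F n = refl

    0<∣beside∣ : ∀ i n → 0 ℕ.< ℤ.∣ beside i n ∣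
    0<∣beside∣ i n = subst (0 ℕ.<_) (sym (∣beside∣ i n)) ℕ.z<s

    far : Fin 2 → ℕ → V (Γ ∖ wall)
    far i n = (beside i n , replicate k 0F) , clear (beside i n) (0<∣beside∣ i n) (replicate k 0F)

    -- A vertex on side `i` one level beyond the height of the list escapes it, and is linked to the
    -- first one because only level 0 is missing.
    far-infinite : ∀ i → Infinite (Linked (Γ ∖ wall) (far i 0))
    far-infinite i xs = far i N
      , linked-same-side wall 0 clear (beside i 0) (beside i N) (0<∣beside∣ i 0) (0<∣beside∣ i N)
          (trans (side-beside i 0) (sym (side-beside i N)))
          (replicate k 0F) (replicate k 0F) (proj₂ (far i 0)) (proj₂ (far i N))
      , λ x∈xs → ℕ.<-irrefl refl (subst (ℕ._≤ N) (∣beside∣ i N)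
          (≤-height (List.map proj₁ xs) (∈-map⁺ proj₁ x∈xs)))
      where
      N : ℕ
      N = height (List.map proj₁ xs)

    side-E : ∀ x y → E (Γ ∖ wall) x y → side (proj₁ (proj₁ x)) ≡ side (proj₁ (proj₁ y))
    side-E ((l , v) , _) ((l′ , v′) , p) (l′≡l+1 , _) =
      trans (side-+1 l (λ eq → p (∈-wall⁺ (trans l′≡l+1 eq)))) (cong side (sym l′≡l+1))

    linked-side : ∀ {x y} → Linked (Γ ∖ wall) x y → side (proj₁ (proj₁ x)) ≡ side (proj₁ (proj₁ y))
    linked-side = Eq.gfold isEquivalence (λ x → side (proj₁ (proj₁ x))) λ {x} {y} → side-E x y

  twoEnded : TwoEnded Γ
  twoEnded = connected
    , (wall , (λ i → far i 0) , far-infinite , λ {i} {j} linked →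
        trans (sym (side-beside i 0)) (trans (linked-side linked) (side-beside j 0)))
    , atMostTwoEnds

corollary12 : ∀ (d k : ℕ) → d ≥ 2 → k ≥ 1 →
    TwoEnded (Z (K⃗ (suc d)) k)
    × (∀ v → InValency (Z (K⃗ (suc d)) k) v d × OutValency (Z (K⃗ (suc d)) k) v d)
    × SharplyArcTransitive (Z (K⃗ (suc d)) k) k
-- The bound on `d` provides three vertices of `K⃗`, needed for the zigzags and for the values 0, 1,
-- 2 in `NotTransitive`.
corollary12 (suc (suc d)) (suc k) (s≤s (s≤s z≤n)) (s≤s z≤n) =
    Ends.twoEnded d (suc k)
  , (λ v → inValency (K⃗-inValency (2 ℕ.+ d)) v , outValency (K⃗-outValency (2 ℕ.+ d)) v)
  , arcTransitive (K⃗-arcTransitive (3 ℕ.+ d))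
  , NotTransitive.¬arcTransitive d k
  where open Layered (K⃗ (3 ℕ.+ d)) (suc k)
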